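{- For coprime positive integers $a,b$ and $i=0,\ldots,a-1$, the number $\mathtt{sch}(a,b,i)$ of (small) $(a,b)$-Schröder paths with exactly $i$ diagonal steps is $$\mathtt{sch}(a,b,i) = \frac{1}{a}\binom{b-1}{i}\binom{a+b-1-i}{b} = \frac{1}{b}\binom{a-1}{i}\binom{a+b-1-i}{a}.$$
   Context: A lattice path from $(0,0)$ to $(b,a)$ is a sequence of $a$ north steps $N=(0,1)$ and $b$ east steps $E=(1,0)$. For coprime positive integers $a,b$, let $\nu(a,b)$ be the unique lowest lattice path from $(0,0)$ to $(b,a)$ that stays weakly above the line segment from $(0,0)$ to $(b,a)$. A (small) $(a,b)$-Schröder path is a path from $(0,0)$ to $(b,a)$ with steps $N$, $E$, $D=(1,1)$ (diagonal) which stays weakly above $\nu(a,b)$. Binomial coefficients $\binom{n}{k}$ with $k>n\ge 0$ are $0$. -}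

module Defs where

open import Data.Empty using (⊥-elim)
open import Data.List using (List; []; _∷_; foldl; replicate)
open import Data.List.Properties using (∷-injectiveʳ)
open import Data.List.Relation.Binary.Pointwise using (Pointwise; []; _∷_)
open import Data.List.Relation.Unary.All as All using (All; []; _∷_)
open import Data.Nat using (ℕ; zero; suc; _+_; _*_; _≤_; _≤?_; z≤n)
open import Data.Nat.Properties
open import Data.Product using (_×_; _,_; proj₁; proj₂; ∃!)
open import Data.Product.Properties using (,-injectiveˡ)
open import Data.Refinement using (Refinement-syntax)
open import Relation.Binary.PropositionalEquality
open import Relation.Nullary using (yes; no)

Point : Set
Point = ℕ × ℕ

data Step : Set where
  N E D : Step

move : Point → Step → Point
move (x , y) N = (x , suc y)
move (x , y) E = (suc x , y)
move (x , y) D = (suc x , suc y)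

-- A path is its sequence of steps; its starting point is supplied separately.

endpoint : Point → List Step → Point
endpoint = foldl move

vertices : Point → List Step → List Point
vertices p []      = p ∷ []
vertices p (s ∷ w) = p ∷ vertices (move p s) w

diagonals : List Step → ℕ
diagonals []      = 0
diagonals (D ∷ w) = suc (diagonals w)
diagonals (_ ∷ w) = diagonals w

record LatticePath (a b : ℕ) (w : List Step) : Set where
  constructor latticePath
  field
    no-diagonal : All (_≢ D) w
    reaches     : endpoint (0 , 0) w ≡ (b , a)

-- The line from (0,0) to (b,a) is a x = b y.  The half-plane above it is
-- convex, so a path lies in it as soon as its vertices do.

AboveSegment : (a b : ℕ) → List Step → Set
AboveSegment a b w = All (λ (x , y) → a * x ≤ b * y) (vertices (0 , 0) w)

-- Each unit column k ≤ x ≤ k + 1 is crossed by exactly one step of a path, an E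
-- or a D, which is the graph of an affine function.  The profile of a path
-- starting at height y lists, column by column, the values of that function at
-- the left and right ends of the column.

profile : ℕ → List Step → List (ℕ × ℕ)
profile y []      = []
profile y (N ∷ w) = profile (suc y) w
profile y (E ∷ w) = (y , y) ∷ profile y w
profile y (D ∷ w) = (y , suc y) ∷ profile (suc y) w

-- For paths from (0,0) to a common endpoint, π stays weakly above μ as a curve
-- in the plane exactly when the affine function of π dominates that of μ on
-- every column, that is, at both ends of every column.  (So a D step cannot cut
-- a corner N E of μ, although its two ends lie on μ.)

Dominates : List (ℕ × ℕ) → List (ℕ × ℕ) → Set
Dominates = Pointwise (λ (l , r) (l′ , r′) → l′ ≤ l × r′ ≤ r)

WeaklyAbove : List Step → List Step → Set
WeaklyAbove π μ = Dominates (profile 0 π) (profile 0 μ)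

record IsLowestAbove (a b : ℕ) (w : List Step) : Set where
  field
    path   : LatticePath a b w
    above  : AboveSegment a b w
    lowest : ∀ μ → LatticePath a b μ → AboveSegment a b μ → WeaklyAbove μ w

module Lowest where

  endpoint-mono : ∀ x y w → x ≤ proj₁ (endpoint (x , y) w) × y ≤ proj₂ (endpoint (x , y) w)
  endpoint-mono x y [] = ≤-refl , ≤-refl
  endpoint-mono x y (N ∷ w) with p , q ← endpoint-mono x (suc y) w = p , m+n≤o⇒n≤o 1 q
  endpoint-mono x y (E ∷ w) with p , q ← endpoint-mono (suc x) y w = m+n≤o⇒n≤o 1 p , q
  endpoint-mono x y (D ∷ w) with p , q ← endpoint-mono (suc x) (suc y) w =
    m+n≤o⇒n≤o 1 p , m+n≤o⇒n≤o 1 q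

  profile-≥ : ∀ y w → All (λ (l , r) → y ≤ l) (profile y w)
  profile-≥ y []      = []
  profile-≥ y (N ∷ w) = All.map (m+n≤o⇒n≤o 1) (profile-≥ (suc y) w)
  profile-≥ y (E ∷ w) = ≤-refl ∷ profile-≥ y w
  profile-≥ y (D ∷ w) = ≤-refl ∷ All.map (m+n≤o⇒n≤o 1) (profile-≥ (suc y) w)

  antisym : ∀ {xs ys} → Dominates xs ys → Dominates ys xs → xs ≡ ys
  antisym [] [] = refl
  antisym ((p , q) ∷ r) ((p′ , q′) ∷ r′) =
    cong₂ _∷_ (cong₂ _,_ (≤-antisym p′ p) (≤-antisym q′ q)) (antisym r r′)

  profile-injective : ∀ x y v w → All (_≢ D) v → All (_≢ D) w →
    endpoint (x , y) v ≡ endpoint (x , y) w → profile y v ≡ profile y w → v ≡ w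
  profile-injective x y (D ∷ v) w (d ∷ _) _ _ _ = ⊥-elim (d refl)
  profile-injective x y v (D ∷ w) _ (d ∷ _) _ _ = ⊥-elim (d refl)
  profile-injective x y [] [] _ _ _ _ = refl
  profile-injective x y [] (N ∷ w) _ _ e _ =
    ⊥-elim (1+n≰n (subst (suc y ≤_) (sym (cong proj₂ e)) (proj₂ (endpoint-mono x (suc y) w))))
  profile-injective x y (N ∷ v) [] _ _ e _ =
    ⊥-elim (1+n≰n (subst (suc y ≤_) (cong proj₂ e) (proj₂ (endpoint-mono x (suc y) v))))
  profile-injective x y [] (E ∷ w) _ _ _ ()
  profile-injective x y (E ∷ v) [] _ _ _ ()
  profile-injective x y (N ∷ v) (N ∷ w) (_ ∷ f) (_ ∷ g) e q =
    cong (N ∷_) (profile-injective x (suc y) v w f g e q)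
  profile-injective x y (E ∷ v) (E ∷ w) (_ ∷ f) (_ ∷ g) e q =
    cong (E ∷_) (profile-injective (suc x) y v w f g e (∷-injectiveʳ q))
  profile-injective x y (N ∷ v) (E ∷ w) _ _ _ q
    with profile (suc y) v | profile-≥ (suc y) v | q
  ... | _ | p ∷ _ | refl = ⊥-elim (1+n≰n p)
  profile-injective x y (E ∷ v) (N ∷ w) _ _ _ q
    with profile (suc y) w | profile-≥ (suc y) w | q
  ... | _ | p ∷ _ | refl = ⊥-elim (1+n≰n p)

  unique : ∀ {a b v w} → IsLowestAbove a b v → IsLowestAbove a b w → v ≡ w
  unique {v = v} {w} V W =
    profile-injective 0 0 v w V.path.no-diagonal W.path.no-diagonal
      (trans V.path.reaches (sym W.path.reaches))
      (antisym (W.lowest v V.path V.above) (V.lowest w W.path W.above))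
    where
    module V where
      open IsLowestAbove V public
      module path = LatticePath path
    module W where
      open IsLowestAbove W public
      module path = LatticePath path

  -- From (x , y), with e steps E and n steps N left, go east whenever possible.

  greedy : (a b x y e n : ℕ) → List Step
  greedy a b x y zero    n = replicate n N
  greedy a b x y (suc e) n with a * suc x ≤? b * y
  greedy a b x y (suc e) n       | yes _ = E ∷ greedy a b (suc x) y e n
  greedy a b x y (suc e) (suc n) | no _  = N ∷ greedy a b x (suc y) (suc e) n
  greedy a b x y (suc e) zero    | no _  = []

  stuck : ∀ {a b} x y e → x + suc e ≡ b → y + 0 ≡ a → a * suc x ≤ b * y
  stuck x y e refl refl rewrite +-identityʳ y | *-comm y (suc x) | +-suc x e =
    *-monoˡ-≤ y (m≤m+n (suc x) e)

  Above : ℕ → ℕ → Point → List Step → Set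
  Above a b p w = All (λ (x , y) → a * x ≤ b * y) (vertices p w)

  higher : ∀ {c} b y → c ≤ b * y → c ≤ b * suc y
  higher b y p = ≤-trans p (*-monoʳ-≤ b (n≤1+n y))

  greedy-path : ∀ a b x y e n → x + e ≡ b → y + n ≡ a → a * x ≤ b * y →
    let w = greedy a b x y e n in
    All (_≢ D) w × endpoint (x , y) w ≡ (b , a) × Above a b (x , y) w
  greedy-path a b x y zero zero p q r =
    [] , cong₂ _,_ (trans (sym (+-identityʳ x)) p) (trans (sym (+-identityʳ y)) q) , r ∷ []
  greedy-path a b x y zero (suc n) p q r
    with f , g , h ← greedy-path a b x (suc y) zero n p (trans (sym (+-suc y n)) q) (higher b y r) =
    (λ ()) ∷ f , g , r ∷ h
  greedy-path a b x y (suc e) n p q r with a * suc x ≤? b * y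
  greedy-path a b x y (suc e) n p q r | yes s
    with f , g , h ← greedy-path a b (suc x) y e n (trans (sym (+-suc x e)) p) q s =
    (λ ()) ∷ f , g , r ∷ h
  greedy-path a b x y (suc e) (suc n) p q r | no s
    with f , g , h ← greedy-path a b x (suc y) (suc e) n p (trans (sym (+-suc y n)) q) (higher b y r) =
    (λ ()) ∷ f , g , r ∷ h
  greedy-path a b x y (suc e) zero p q r | no s = ⊥-elim (s (stuck x y e p q))

  profile-N : ∀ y n → profile y (replicate n N) ≡ []
  profile-N y zero    = refl
  profile-N y (suc n) = profile-N (suc y) n

  profile-vertical : ∀ x y w → proj₁ (endpoint (x , y) w) ≡ x → profile y w ≡ []
  profile-vertical x y []      e = refl
  profile-vertical x y (N ∷ w) e = profile-vertical x (suc y) w e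
  profile-vertical x y (E ∷ w) e =
    ⊥-elim (1+n≰n (subst (suc x ≤_) e (proj₁ (endpoint-mono (suc x) y w))))
  profile-vertical x y (D ∷ w) e =
    ⊥-elim (1+n≰n (subst (suc x ≤_) e (proj₁ (endpoint-mono (suc x) (suc y) w))))

  greedy-lowest : ∀ a b x y e n y′ μ → x + e ≡ b → y + n ≡ a → y ≤ y′ →
    All (_≢ D) μ → endpoint (x , y′) μ ≡ (b , a) → Above a b (x , y′) μ →
    Dominates (profile y′ μ) (profile y (greedy a b x y e n))
  greedy-lowest a b x y zero n y′ μ p q r f g h
    rewrite profile-N y n
          | profile-vertical x y′ μ (trans (,-injectiveˡ g) (trans (sym p) (+-identityʳ x))) = []
  greedy-lowest a b x y (suc e) n y′ [] p q r f g h =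
    ⊥-elim (m≢1+m+n x (trans (,-injectiveˡ g) (trans (sym p) (+-suc x e))))
  greedy-lowest a b x y (suc e) n y′ (D ∷ μ) p q r (d ∷ _) g h = ⊥-elim (d refl)
  greedy-lowest a b x y (suc e) n y′ (N ∷ μ) p q r (_ ∷ f) g (_ ∷ h) =
    greedy-lowest a b x y (suc e) n (suc y′) μ p q (m≤n⇒m≤1+n r) f g h
  greedy-lowest a b x y (suc e) n y′ (E ∷ μ) p q r (d ∷ f) g (c ∷ h) with a * suc x ≤? b * y
  greedy-lowest a b x y (suc e) n y′ (E ∷ μ) p q r (d ∷ f) g (c ∷ h) | yes s =
    (r , r) ∷ greedy-lowest a b (suc x) y e n y′ μ (trans (sym (+-suc x e)) p) q r f g h
  greedy-lowest a b x y (suc e) (suc n) y′ (E ∷ μ) p q r (d ∷ f) g (c ∷ h) | no s =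
    greedy-lowest a b x (suc y) (suc e) n y′ (E ∷ μ) p (trans (sym (+-suc y n)) q)
      (≤∧≢⇒< r λ { refl → s (first (suc x) y μ h) }) (d ∷ f) g (c ∷ h)
    where
    first : ∀ x y w → Above a b (x , y) w → a * x ≤ b * y
    first x y []      (v ∷ _) = v
    first x y (_ ∷ _) (v ∷ _) = v
  greedy-lowest a b x y (suc e) zero y′ (E ∷ μ) p q r f g h | no s = ⊥-elim (s (stuck x y e p q))

lowestAbove : ∀ a b → ∃! _≡_ (IsLowestAbove a b)
lowestAbove a b = Lowest.greedy a b 0 0 b a , isLowest , Lowest.unique isLowest
  where
  open Lowest

  start : a * 0 ≤ b * 0
  start = ≤-trans (≤-reflexive (*-zeroʳ a)) z≤n

  isLowest : IsLowestAbove a b (greedy a b 0 0 b a)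
  isLowest with f , g , h ← greedy-path a b 0 0 b a refl refl start = record
    { path   = latticePath f g
    ; above  = h
    ; lowest = λ μ (latticePath f′ g′) h′ → greedy-lowest a b 0 0 b a 0 μ refl refl z≤n f′ g′ h′
    }

ν : ℕ → ℕ → List Step
ν a b = proj₁ (lowestAbove a b)

record IsSchröderPath (a b : ℕ) (π : List Step) : Set where
  constructor schröderPath
  field
    reaches : endpoint (0 , 0) π ≡ (b , a)
    above   : WeaklyAbove π (ν a b)

SchröderPath : (a b i : ℕ) → Set
SchröderPath a b i = [ π ∈ List Step ∣ IsSchröderPath a b π × diagonals π ≡ i ]

{-# OPTIONS --safe #-}

-- Cut a Schröder path after each of its steps E and D, and record for each unit
-- column its number n of N steps and a mark m ∈ {0,1} telling whether the
-- preceding horizontal step was a D.  Staying weakly above ν(a,b) means that the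
-- rises n + m satisfy a x ≤ b (r₁ + ⋯ + r_x) for all x.  By the cycle lemma, each
-- sequence of b columns with total rise a has exactly one rotation satisfying
-- these inequalities, so there are C(b,i) C(a+b-1-i,b-1) / b such sequences with
-- i marks.  A Schröder path is one whose first column is unmarked.  A marked
-- first column (1,n) can be replaced by (0,n+1), so with s(i) paths the count
-- above equals s(i) + s(i-1), and induction on i determines s(i).

module Submission where

open import Defs
open import Data.Bool using (Bool; true; false; if_then_else_)
import Data.Bool.Properties as Bool
open import Data.Empty using (⊥-elim)
import Data.Empty.Irrelevant as Irrelevant
open import Data.Fin using (Fin; zero; suc; toℕ; fromℕ<)
open import Data.Fin.Permutation using (↔⇒≡)
import Data.Fin.Properties as Fin
import Data.Integer.Properties as ℤ
open import Data.Irrelevant using ([_])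
open import Data.List using (List; []; _∷_; _++_; length; map; take; drop; replicate; zip; unzip)
import Data.List.Properties as List
open import Data.List.Relation.Binary.Pointwise using ([]; _∷_)
open import Data.Nat using (ℕ; zero; suc; pred; _+_; _*_; _∸_; _!; _≤_; _<_; _≤?_; _<?_; _≟_;
  z≤n; s≤s; z<s; NonZero; ≢-nonZero⁻¹)
open import Data.Nat.Combinatorics using (_C_; nCk≡n!/k![n-k]!; nCk≡nC[n∸k]; k![n∸k]!∣n!; k>n⇒nCk≡0;
  nCk+nC[k+1]≡[n+1]C[k+1]; nCn≡1)
open import Data.Nat.Coprimality as Coprimality using (Coprime; coprime-divisor)
open import Data.Nat.Divisibility using (_∣_; divides; ∣⇒≤)
open import Data.Nat.DivMod using (m/n*n≡m)
open import Data.Nat.ListAction using (sum)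
open import Data.Nat.ListAction.Properties using (sum-++)
open import Data.Nat.Properties hiding (_≟_; _≤?_; _<?_)
open import Data.Nat.Tactic.RingSolver using (solve-∀)
open import Algebra.Properties.CommutativeSemigroup *-commutativeSemigroup using (x∙yz≈y∙xz)
open import Data.Product using (_×_; _,_; proj₁; proj₂; ∃-syntax; uncurry)
open import Data.Product.Function.NonDependent.Propositional using (_×-↔_)
import Data.Product.Properties as Product
open import Data.Rational using (_/_)
open import Data.Rational.Properties using (fromℚᵘ-cong)
open import Data.Rational.Unnormalised using (mkℚᵘ; *≡*)
open import Data.Refinement using (Refinement-syntax; _,_; value; value-injective)
open import Data.Sum using (_⊎_; inj₁; inj₂; [_,_]′)
open import Data.Sum.Function.Propositional using (_⊎-↔_)
import Data.Sum.Properties as Sum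
open import Data.Unit using (⊤; tt)
open import Function using (_∘_)
open import Function.Bundles using (_↔_; mk↔ₛ′; Inverse)
open import Function.Properties.Inverse using (↔-refl; ↔-sym; ↔-trans)
open import Relation.Binary.Definitions using (DecidableEquality)
open import Relation.Binary.PropositionalEquality
open import Relation.Nullary using (Dec; yes; no; ¬_; recompute)
open import Relation.Nullary.Decidable using (_×-dec_)
open import Relation.Unary using (Decidable)

-- Binomial coefficients

choose-! : ∀ {n} p q → n ≡ p + q → (n C p) * (p ! * q !) ≡ n !
choose-! {n} p q refl = begin
  (n C p) * (p ! * q !)        ≡⟨ cong (λ r → (n C p) * (p ! * r !)) (m+n∸m≡n p q) ⟨
  (n C p) * (p ! * (n ∸ p) !)  ≡⟨ cong (_* (p ! * (n ∸ p) !)) (nCk≡n!/k![n-k]! p≤n) ⟩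
  _                            ≡⟨ m/n*n≡m (k![n∸k]!∣n! p≤n) ⟩
  n !                          ∎
  where
  open ≡-Reasoning
  p≤n = m≤m+n p q
  instance _ = p !* (n ∸ p) !≢0

-- `m C i` absorbs `i ! * k !` into `m !`, the factor `suc m` makes this `suc m !`, and the other
-- binomial absorbs it together with `l !` into `n !`. The value depends only on `i + k + l`.
weighted-choose : ∀ {m n} i k l → m ≡ i + k → n ≡ suc (m + l) →
  (i ! * k ! * l !) * (suc m * ((m C i) * (n C suc m))) ≡ n !
weighted-choose {m} {n} i k l m≡ n≡ = begin
  (i ! * k ! * l !) * (suc m * (X * Y))    ≡⟨ shuffle (i !) (k !) (l !) (suc m) X Y ⟩
  Y * (suc m * (X * (i ! * k !)) * l !)    ≡⟨ cong (λ u → Y * (suc m * u * l !)) (choose-! i k m≡) ⟩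
  Y * (suc m ! * l !)                      ≡⟨ choose-! (suc m) l n≡ ⟩
  n !                                      ∎
  where
  open ≡-Reasoning
  X = m C i
  Y = n C suc m
  shuffle : ∀ i k l c x y → (i * k * l) * (c * (x * y)) ≡ y * (c * (x * (i * k)) * l)
  shuffle = solve-∀

-- b times the number of paths with i diagonal steps.
scaled : (a b i : ℕ) → ℕ
scaled a b i = ((a ∸ 1) C i) * ((a + b ∸ 1 ∸ i) C a)

-- The recurrence for height `2 + i + k` and `suc (i + l)` columns, freed of truncated subtraction.
-- Multiplied by `M`, each product becomes a polynomial multiple of the one factorial `F`, and
-- `polynomial` is what remains.
scaled-recurrence-! : ∀ i k l →
  ((suc i + k) C suc i) * ((suc i + k + l) C (2 + i + k)) +
  ((suc i + k) C i) * ((2 + i + k + l) C (2 + i + k))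
  ≡ ((suc i + l) C suc i) * ((suc i + k + l) C (i + l))
scaled-recurrence-! i k l = *-cancelˡ-≡ _ _ (suc i ! * suc k ! * l ! * (2 + i + k)) (begin
  M * (A + B) ≡⟨ *-distribˡ-+ M A B ⟩
  M * A + M * B ≡⟨ cong₂ _+_ (first l) second ⟩
  suc k * l * F + suc i * ((2 + i + k + l) * F) ≡⟨ polynomial i k l F ⟩
  (2 + i + k) * (suc i + l) * F ≡⟨ third ⟨
  M * R ∎)
  where
  open ≡-Reasoning
  M = suc i ! * suc k ! * l ! * (2 + i + k)
  F = (suc i + k + l) !
  A = ((suc i + k) C suc i) * ((suc i + k + l) C (2 + i + k))
  B = ((suc i + k) C i) * ((2 + i + k + l) C (2 + i + k))
  R = ((suc i + l) C suc i) * ((suc i + k + l) C (i + l))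
  instance
    _ = suc i !≢0
    _ = suc k !≢0
    _ = l !≢0
    _ = m*n≢0 (suc i !) (suc k !)
    _ = m*n≢0 (suc i ! * suc k !) (l !)
    _ = m*n≢0 (suc i ! * suc k ! * l !) (2 + i + k)

  polynomial : ∀ i k l F → suc k * l * F + suc i * ((2 + i + k + l) * F) ≡ (2 + i + k) * (suc i + l) * F
  polynomial = solve-∀

  first : ∀ l → suc i ! * suc k ! * l ! * (2 + i + k) *
    (((suc i + k) C suc i) * ((suc i + k + l) C (2 + i + k))) ≡ suc k * l * (suc i + k + l) !
  -- For `l = 0` the second binomial has its lower index above its upper one, matching the factor
  -- `l` on the right.
  first zero rewrite k>n⇒nCk≡0 {suc i + k + 0} {2 + i + k} (≤-reflexive (cong (2 +_) (+-identityʳ (i + k))))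
    | *-zeroʳ ((suc i + k) C suc i) | *-zeroʳ (suc i ! * suc k ! * 1 * (2 + i + k)) | *-zeroʳ k = refl
  first (suc l) = begin
    suc i ! * suc k ! * suc l ! * (2 + i + k) * (X * Y)
      ≡⟨ shuffle (suc i !) (suc k) (k !) (suc l) (l !) (2 + i + k) X Y ⟩
    suc k * suc l * (suc i ! * k ! * l ! * ((2 + i + k) * (X * Y)))
      ≡⟨ cong (suc k * suc l *_) weighted ⟩
    suc k * suc l * (suc i + k + suc l) ! ∎
    where
    X = (suc i + k) C suc i
    Y = (suc i + k + suc l) C (2 + i + k)
    weighted : suc i ! * k ! * l ! * ((2 + i + k) * (X * Y)) ≡ (suc i + k + suc l) !
    weighted = weighted-choose (suc i) k l refl (+-suc (suc i + k) l)
    shuffle : ∀ i k k′ l l′ c x y → i * (k * k′) * (l * l′) * c * (x * y) ≡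
                                 k * l * (i * k′ * l′ * (c * (x * y)))
    shuffle = solve-∀

  second : M * B ≡ suc i * ((2 + i + k + l) * F)
  second = begin
    M * B ≡⟨ shuffle (suc i) (i !) (suc k !) (l !) (2 + i + k) X Y ⟩
    suc i * (i ! * suc k ! * l ! * ((2 + i + k) * (X * Y))) ≡⟨ cong (suc i *_) weighted ⟩
    suc i * (2 + i + k + l) ! ∎
    where
    X = (suc i + k) C i
    Y = (2 + i + k + l) C (2 + i + k)
    weighted : i ! * suc k ! * l ! * ((2 + i + k) * (X * Y)) ≡ (2 + i + k + l) !
    weighted = weighted-choose i (suc k) l (sym (+-suc i k)) refl
    shuffle : ∀ i i′ k l c x y → i * i′ * k * l * c * (x * y) ≡ i * (i′ * k * l * (c * (x * y)))
    shuffle = solve-∀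

  third : M * R ≡ (2 + i + k) * (suc i + l) * F
  third = begin
    M * R ≡⟨ shuffle (suc i !) (suc k !) (l !) (2 + i + k) X Y ⟩
    (2 + i + k) * (X * (suc i ! * l !)) * (Y * suc k !)
      ≡⟨ cong (λ u → (2 + i + k) * u * (Y * suc k !)) (choose-! (suc i) l refl) ⟩
    (2 + i + k) * (suc i + l) ! * (Y * suc k !)
      ≡⟨ shuffle′ (2 + i + k) (suc i + l) ((i + l) !) Y (suc k !) ⟩
    (2 + i + k) * (suc i + l) * (Y * ((i + l) ! * suc k !))
      ≡⟨ cong ((2 + i + k) * (suc i + l) *_) (choose-! (i + l) (suc k) (rearrange i k l)) ⟩
    (2 + i + k) * (suc i + l) * F ∎
    where
    X = (suc i + l) C suc i
    Y = (suc i + k + l) C (i + l)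
    shuffle : ∀ i k l c x y → i * k * l * c * (x * y) ≡ c * (x * (i * l)) * (y * k)
    shuffle = solve-∀
    shuffle′ : ∀ c d e y k → c * (d * e) * (y * k) ≡ c * d * (y * (e * k))
    shuffle′ = solve-∀
    rearrange : ∀ i k l → suc i + k + l ≡ i + l + suc k
    rearrange = solve-∀

scaled-zero : ∀ a b → scaled (suc a) (suc b) 0 ≡ (suc b C 0) * ((suc a + b) C b)
scaled-zero a b = cong (_+ 0) (begin
  (a + suc b) C suc a             ≡⟨ cong (_C suc a) (+-suc a b) ⟩
  (suc a + b) C suc a             ≡⟨ nCk≡nC[n∸k] {suc a} (m≤m+n (suc a) b) ⟩
  (suc a + b) C (suc a + b ∸ suc a) ≡⟨ cong ((suc a + b) C_) (m+n∸m≡n (suc a) b) ⟩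
  (suc a + b) C b                 ∎)
  where open ≡-Reasoning

scaled-recurrence-+ : ∀ i k b → let a = 2 + i + k in
  scaled a (suc b) (suc i) + scaled a (suc b) i ≡ (suc b C suc i) * ((suc k + b) C b)
scaled-recurrence-+ i k b with i ≤? b
-- Here `suc i` exceeds `suc b`, and all three products contain a vanishing binomial.
... | no i≰b = begin
    scaled a (suc b) (suc i) + scaled a (suc b) i
      ≡⟨ cong₂ _+_ (vanish (suc i) (m≤n⇒m≤1+n small)) (vanish i small) ⟩
    0 ≡⟨ cong (_* ((suc k + b) C b)) (k>n⇒nCk≡0 (s≤s (≰⇒> i≰b))) ⟨
    (suc b C suc i) * ((suc k + b) C b) ∎
  where
  open ≡-Reasoning
  a = 2 + i + k
  vanish : ∀ j → a + suc b ∸ 1 < j + a → scaled a (suc b) j ≡ 0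
  vanish j p rewrite k>n⇒nCk≡0 (m<n+o⇒m∸n<o _ j p) = *-zeroʳ ((a ∸ 1) C j)
  e : ∀ i k b → suc (suc i + k + suc b) ≡ suc b + (2 + i + k)
  e = solve-∀
  small : a + suc b ∸ 1 < i + a
  small = ≤-trans (≤-reflexive (e i k b)) (+-monoˡ-≤ a (≰⇒> i≰b))
... | yes i≤b with l , refl ← m≤n⇒∃[o]m+o≡n i≤b = begin
    scaled a (suc (i + l)) (suc i) + scaled a (suc (i + l)) i
      ≡⟨ cong₂ (λ m n → ((suc i + k) C suc i) * (m C a) + ((suc i + k) C i) * (n C a))
           (shift (suc i) (suc i + k + l) (e₁ i k l)) (shift i (2 + i + k + l) (e₂ i k l)) ⟩
    _ ≡⟨ scaled-recurrence-! i k l ⟩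
    ((suc i + l) C suc i) * ((suc i + k + l) C (i + l))
      ≡⟨ cong (λ m → ((suc i + l) C suc i) * (m C (i + l))) (e₃ i k l) ⟩
    (suc (i + l) C suc i) * ((suc k + (i + l)) C (i + l)) ∎
  where
  open ≡-Reasoning
  a = 2 + i + k
  shift : ∀ {m} i n → m ≡ i + n → m ∸ i ≡ n
  shift i n refl = m+n∸m≡n i n
  e₁ : ∀ i k l → suc i + k + suc (i + l) ≡ suc i + (suc i + k + l)
  e₁ = solve-∀
  e₂ : ∀ i k l → suc i + k + suc (i + l) ≡ i + (2 + i + k + l)
  e₂ = solve-∀
  e₃ : ∀ i k l → suc i + k + l ≡ suc k + (i + l)
  e₃ = solve-∀

-- The right side is the number of all sequences of `suc b` columns of height `suc a` with `suc i`
-- marks; the recurrence determines `scaled` by induction on `i`.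
scaled-recurrence : ∀ a b {i} → suc i ≤ a →
  scaled (suc a) (suc b) (suc i) + scaled (suc a) (suc b) i ≡ (suc b C suc i) * ((a ∸ i + b) C b)
scaled-recurrence a b {i} i<a with k , refl ← m≤n⇒∃[o]m+o≡n i<a =
  trans (scaled-recurrence-+ i k b) (cong (λ s → (suc b C suc i) * ((s + b) C b))
    (sym (trans (cong (_∸ i) (sym (+-suc i k))) (m+n∸m≡n i (suc k)))))

-- Links the two closed forms. With `a = i + k` and `b = i + l`, both sides times `i ! * k ! * l !`
-- equal `n !` by `weighted-choose`, used once as it stands and once with `k` and `l` exchanged.
scaled-symmetric : ∀ a b {i} → i ≤ a →
  suc a * scaled (suc a) (suc b) i ≡ suc b * ((b C i) * ((suc a + suc b ∸ 1 ∸ i) C suc b))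
scaled-symmetric a b {i} i≤a with k , refl ← m≤n⇒∃[o]m+o≡n i≤a | i ≤? b
-- For `i > b` both sides vanish: on the right `b C i`, on the left a binomial over `suc a` whose
-- upper index is at most `a`.
... | no i≰b
  rewrite k>n⇒nCk≡0 (≰⇒> i≰b)
  | k>n⇒nCk≡0 (m<n+o⇒m∸n<o (suc a + suc b ∸ 1) i {suc a}
      (≤-trans (≤-reflexive (trans (cong suc (+-comm a (suc b))) (sym (+-suc (suc b) a))))
               (+-monoˡ-≤ (suc a) (≰⇒> i≰b))))
  | *-zeroʳ (a C i) | *-zeroʳ a | *-zeroʳ b = refl
... | yes i≤b with l , refl ← m≤n⇒∃[o]m+o≡n i≤b = *-cancelˡ-≡ _ _ (i ! * k ! * l !) (begin
    i ! * k ! * l ! * (suc a * ((a C i) * (n C suc a))) ≡⟨ weighted-choose i k l refl (shift (e₁ i k l)) ⟩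
    n ! ≡⟨ weighted-choose i l k refl (shift (e₂ i k l)) ⟨
    i ! * l ! * k ! * (suc b * ((b C i) * (n C suc b)))
      ≡⟨ cong (_* (suc b * ((b C i) * (n C suc b)))) (swap (i !) (l !) (k !)) ⟩
    i ! * k ! * l ! * (suc b * ((b C i) * (n C suc b))) ∎)
  where
  open ≡-Reasoning
  n = suc a + suc b ∸ 1 ∸ i
  shift : ∀ {m} → a + suc b ≡ i + m → n ≡ m
  shift e = trans (cong (_∸ i) e) (m+n∸m≡n i _)
  e₁ : ∀ i k l → i + k + suc (i + l) ≡ i + suc (i + k + l)
  e₁ = solve-∀
  e₂ : ∀ i k l → i + k + suc (i + l) ≡ i + suc (i + l + k)
  e₂ = solve-∀
  swap : ∀ x y z → x * y * z ≡ x * z * y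
  swap = solve-∀
  instance
    _ = i !≢0
    _ = k !≢0
    _ = l !≢0
    _ = m*n≢0 (i !) (k !)
    _ = m*n≢0 (i ! * k !) (l !)

-- Counting refinement types

variable
  A B : Set
  P P′ : A → Set
  Q Q′ : B → Set

-- The round-trip equations hold only on members, and membership proofs are irrelevant, so the
-- equations are recomputed from decidable equality.
refinement-↔ : DecidableEquality A → DecidableEquality B → (f : A → B) (g : B → A) →
  (∀ {x} → P x → Q (f x)) → (∀ {y} → Q y → P (g y)) →
  (∀ {y} → Q y → f (g y) ≡ y) → (∀ {x} → P x → g (f x) ≡ x) →
  [ x ∈ A ∣ P x ] ↔ [ y ∈ B ∣ Q y ]
refinement-↔ _≟A_ _≟B_ f g p q fg gf = mk↔ₛ′
  (λ { (x , [ u ]) → f x , [ p u ] })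
  (λ { (y , [ v ]) → g y , [ q v ] })
  (λ { (y , [ v ]) → value-injective (recompute (f (g y) ≟B y) (fg v)) })
  (λ { (x , [ u ]) → value-injective (recompute (g (f x) ≟A x) (gf u)) })

refinement-×-↔ : ([ x ∈ A ∣ P x ] × [ y ∈ B ∣ Q y ]) ↔ [ (x , y) ∈ A × B ∣ P x × Q y ]
refinement-×-↔ = mk↔ₛ′
  (λ { ((x , [ p ]) , (y , [ q ])) → (x , y) , [ p , q ] })
  (λ { ((x , y) , [ r ]) → (x , [ proj₁ r ]) , (y , [ proj₂ r ]) })
  (λ _ → refl) (λ _ → refl)

refinement-⊎-↔ : ([ x ∈ A ∣ P x ] ⊎ [ y ∈ B ∣ Q y ]) ↔ [ z ∈ A ⊎ B ∣ [ P , Q ]′ z ]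
refinement-⊎-↔ = mk↔ₛ′
  (λ { (inj₁ (x , p)) → inj₁ x , p ; (inj₂ (y , q)) → inj₂ y , q })
  (λ { (inj₁ x , p) → inj₁ (x , p) ; (inj₂ y , q) → inj₂ (y , q) })
  (λ { (inj₁ x , _) → refl ; (inj₂ y , _) → refl })
  (λ { (inj₁ x) → refl ; (inj₂ y) → refl })

Fin0↔empty : (∀ {x} → ¬ P x) → Fin 0 ↔ [ x ∈ A ∣ P x ]
Fin0↔empty ¬p = mk↔ₛ′ (λ ()) (λ { (x , [ p ]) → Irrelevant.⊥-elim (¬p p) })
  (λ { (x , [ p ]) → Irrelevant.⊥-elim (¬p p) }) (λ ())

Fin1↔singleton : DecidableEquality A → ∀ x → P x → (∀ {y} → P y → x ≡ y) → Fin 1 ↔ [ x ∈ A ∣ P x ]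
Fin1↔singleton _≟A_ x p unique = mk↔ₛ′ (λ _ → x , [ p ]) (λ _ → zero)
  (λ { (y , [ q ]) → value-injective (recompute (x ≟A y) (unique q)) }) (λ { zero → refl })

Fin↔below : ∀ n → Fin n ↔ [ r ∈ ℕ ∣ r < n ]
Fin↔below n = mk↔ₛ′ (λ i → toℕ i , [ Fin.toℕ<n i ]) (λ { (r , [ p ]) → fromℕ< p })
  (λ { (r , [ p ]) → value-injective (Fin.toℕ-fromℕ< p) }) (λ i → Fin.fromℕ<-toℕ i (Fin.toℕ<n i))

Fin-subset : ∀ n {P : Fin n → Set} → Decidable P → ∃[ m ] Fin m ↔ [ i ∈ Fin n ∣ P i ]
Fin-subset zero    P? = 0 , mk↔ₛ′ (λ ()) (λ ()) (λ ()) (λ ())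
Fin-subset (suc n) P? with m , e ← Fin-subset n (P? ∘ suc) | P? zero
... | yes p = suc m , mk↔ₛ′
  (λ { zero → zero , [ p ] ; (suc i) → up (e.to i) })
  (λ { (zero , _) → zero ; (suc i , [ q ]) → suc (e.from (i , [ q ])) })
  (λ { (zero , [ _ ]) → refl ; (suc i , [ q ]) → cong up (e.strictlyInverseˡ (i , [ q ])) })
  (λ { zero → refl ; (suc i) → cong suc (e.strictlyInverseʳ i) })
  where
  module e = Inverse e
  up : [ i ∈ Fin n ∣ _ ] → [ i ∈ Fin (suc n) ∣ _ ]
  up (i , q) = suc i , q
... | no ¬p = m , mk↔ₛ′
  (up ∘ e.to)
  (λ { (zero , [ q ]) → Irrelevant.⊥-elim (¬p q) ; (suc i , [ q ]) → e.from (i , [ q ]) })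
  (λ { (zero , [ q ]) → Irrelevant.⊥-elim (¬p q)
     ; (suc i , [ q ]) → cong up (e.strictlyInverseˡ (i , [ q ])) })
  e.strictlyInverseʳ
  where
  module e = Inverse e
  up : [ i ∈ Fin n ∣ _ ] → [ i ∈ Fin (suc n) ∣ _ ]
  up (i , q) = suc i , q

-- Supplies a cardinality before its value is known; the counting arguments determine the value
-- afterwards. The predicate is pulled back along the enumeration and filtered on `Fin n`.
finite-subset : ∀ {n} → Fin n ↔ [ x ∈ A ∣ P x ] → Decidable P′ →
  ∃[ m ] Fin m ↔ [ x ∈ A ∣ P x × P′ x ]
finite-subset {A = A} {P = P} {P′ = P′} {n} e P′? = m , ↔-trans i (mk↔ₛ′
  (λ { (j , [ q ]) → both (e.to j) q })
  (λ { (x , [ r ]) → e.from (x , [ proj₁ r ]) ,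
                     [ subst (P′ ∘ value) (sym (e.strictlyInverseˡ (x , [ proj₁ r ]))) (proj₂ r) ] })
  (λ { (x , [ r ]) → value-injective (cong value (e.strictlyInverseˡ (x , [ proj₁ r ]))) })
  (λ { (j , [ q ]) → value-injective (e.strictlyInverseʳ j) }))
  where
  module e = Inverse e
  m,i = Fin-subset n (P′? ∘ value ∘ e.to)
  m = proj₁ m,i
  i = proj₂ m,i
  both : (v : [ x ∈ A ∣ P x ]) → .(P′ (value v)) → [ x ∈ A ∣ P x × P′ x ]
  both (x , [ p ]) q = x , [ p , q ]

-- Enumeration of sequences of marked columns.

bit : Bool → ℕ
bit m = if m then 1 else 0

Fin-cong : ∀ {m n} → m ≡ n → Fin m ↔ Fin n
Fin-cong refl = ↔-refl

_≟ᴮ_ : DecidableEquality (List Bool)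
_≟ᴮ_ = List.≡-dec Bool._≟_

_≟ᴺ_ : DecidableEquality (List ℕ)
_≟ᴺ_ = List.≡-dec _≟_

IsSubset : ℕ → ℕ → List Bool → Set
IsSubset n k ms = length ms ≡ n × sum (map bit ms) ≡ k

-- Pascal's rule, read on the first letter of the characteristic word of the subset.
Fin↔Subsets : ∀ n k → Fin (n C k) ↔ [ ms ∈ List Bool ∣ IsSubset n k ms ]
Fin↔Subsets zero zero = Fin1↔singleton _≟ᴮ_ [] (refl , refl) (λ { {[]} _ → refl ; {_ ∷ _} (() , _) })
Fin↔Subsets zero (suc k) = Fin0↔empty (λ { {[]} (_ , ()) ; {_ ∷ _} (() , _) })
Fin↔Subsets (suc n) zero = ↔-trans (Fin↔Subsets n zero)
  (refinement-↔ _≟ᴮ_ _≟ᴮ_ (false ∷_) (drop 1) (λ { (refl , q) → refl , q })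
    (λ { {[]} (() , _) ; {true ∷ _} (_ , ()) ; {false ∷ _} (refl , q) → refl , q })
    (λ { {[]} (() , _) ; {true ∷ _} (_ , ()) ; {false ∷ _} _ → refl })
    (λ _ → refl))
Fin↔Subsets (suc n) (suc k) = ↔-trans (Fin-cong (sym (nCk+nC[k+1]≡[n+1]C[k+1] n k)))
  (↔-trans Fin.+↔⊎ (↔-trans (Fin↔Subsets n k ⊎-↔ Fin↔Subsets n (suc k)) (↔-trans refinement-⊎-↔ split)))
  where
  join : List Bool ⊎ List Bool → List Bool
  join = [ true ∷_ , false ∷_ ]′
  unjoin : List Bool → List Bool ⊎ List Bool
  unjoin (true ∷ ms) = inj₁ ms
  unjoin (false ∷ ms) = inj₂ ms
  -- Default value, never met on words of length `suc n`.
  unjoin [] = inj₁ []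
  split : [ z ∈ _ ∣ [ IsSubset n k , IsSubset n (suc k) ]′ z ] ↔
          [ ms ∈ List Bool ∣ IsSubset (suc n) (suc k) ms ]
  split = refinement-↔ (Sum.≡-dec _≟ᴮ_ _≟ᴮ_) _≟ᴮ_ join unjoin
    (λ { {inj₁ _} (p , q) → cong suc p , cong suc q ; {inj₂ _} (p , q) → cong suc p , q })
    (λ { {[]} (() , _) ; {true ∷ _} (p , q) → suc-injective p , suc-injective q
       ; {false ∷ _} (p , q) → suc-injective p , q })
    (λ { {[]} (() , _) ; {true ∷ _} _ → refl ; {false ∷ _} _ → refl })
    (λ { {inj₁ _} _ → refl ; {inj₂ _} _ → refl })

IsComposition : ℕ → ℕ → List ℕ → Set
IsComposition n s ns = length ns ≡ n × sum ns ≡ s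

-- Stars and bars for weak compositions: a first part 0 is dropped, a positive one is lowered by
-- one, and Pascal's rule adds the two cases. There are `suc n` parts, hence `n` bars.
Fin↔Compositions : ∀ n s → Fin ((s + n) C n) ↔ [ ns ∈ List ℕ ∣ IsComposition (suc n) s ns ]
Fin↔Compositions zero s = Fin1↔singleton _≟ᴺ_ (s ∷ []) (refl , +-identityʳ s)
  (λ { {[]} (() , _) ; {n ∷ []} (_ , q) → cong (_∷ []) (trans (sym q) (+-identityʳ n))
     ; {_ ∷ _ ∷ _} (() , _) })
Fin↔Compositions (suc n) zero = ↔-trans (Fin-cong (trans (nCn≡1 (suc n)) (sym (nCn≡1 n))))
  (↔-trans (Fin↔Compositions n zero)
  (refinement-↔ _≟ᴺ_ _≟ᴺ_ (0 ∷_) (drop 1) (λ { (p , q) → cong suc p , q })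
    (λ { {[]} (() , _) ; {zero ∷ _} (p , q) → suc-injective p , q ; {suc _ ∷ _} (_ , ()) })
    (λ { {[]} (() , _) ; {zero ∷ _} _ → refl ; {suc _ ∷ _} (_ , ()) })
    (λ _ → refl)))
Fin↔Compositions (suc n) (suc s) =
  ↔-trans (Fin-cong (sym (trans (cong (λ m → (m C n) + ((s + suc n) C suc n)) (sym (+-suc s n)))
                                (nCk+nC[k+1]≡[n+1]C[k+1] (s + suc n) n))))
  (↔-trans Fin.+↔⊎ (↔-trans (Fin↔Compositions n (suc s) ⊎-↔ Fin↔Compositions (suc n) s)
    (↔-trans refinement-⊎-↔ split)))
  where
  join : List ℕ ⊎ List ℕ → List ℕ
  join (inj₁ ns) = 0 ∷ ns
  join (inj₂ []) = []
  join (inj₂ (n ∷ ns)) = suc n ∷ ns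
  unjoin : List ℕ → List ℕ ⊎ List ℕ
  unjoin (zero ∷ ns) = inj₁ ns
  unjoin (suc n ∷ ns) = inj₂ (n ∷ ns)
  unjoin [] = inj₁ []
  split : [ z ∈ _ ∣ [ IsComposition (suc n) (suc s) , IsComposition (2 + n) s ]′ z ] ↔
          [ ns ∈ List ℕ ∣ IsComposition (2 + n) (suc s) ns ]
  split = refinement-↔ (Sum.≡-dec _≟ᴺ_ _≟ᴺ_) _≟ᴺ_ join unjoin
    (λ { {inj₁ _} (p , q) → cong suc p , q ; {inj₂ []} (() , _) ; {inj₂ (_ ∷ _)} (p , q) → p , cong suc q })
    (λ { {[]} (() , _) ; {zero ∷ _} (p , q) → suc-injective p , q
       ; {suc _ ∷ _} (p , q) → p , suc-injective q })
    (λ { {[]} (() , _) ; {zero ∷ _} _ → refl ; {suc _ ∷ _} _ → refl })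
    (λ { {inj₁ _} _ → refl ; {inj₂ []} (() , _) ; {inj₂ (_ ∷ _)} _ → refl })

Column : Set
Column = Bool × ℕ

rise : Column → ℕ
rise (m , n) = bit m + n

height marks : List Column → ℕ
height xs = sum (map rise xs)
marks xs = sum (map (bit ∘ proj₁) xs)

IsColumns : (a b i : ℕ) → List Column → Set
IsColumns a b i xs = (length xs ≡ b × height xs ≡ a) × marks xs ≡ i

_≟ᶜ_ : DecidableEquality (List Column)
_≟ᶜ_ = List.≡-dec (Product.≡-dec Bool._≟_ _≟_)

height-unzip : ∀ xs → height xs ≡ marks xs + sum (proj₂ (unzip xs))
height-unzip [] = refl
height-unzip ((m , n) ∷ xs) rewrite height-unzip xs = interchange (bit m) n (marks xs) _
  where
  interchange : ∀ a b c d → a + b + (c + d) ≡ a + c + (b + d)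
  interchange = solve-∀

marks-unzip : ∀ xs → marks xs ≡ sum (map bit (proj₁ (unzip xs)))
marks-unzip [] = refl
marks-unzip ((m , _) ∷ xs) = cong (bit m +_) (marks-unzip xs)

Unzipped : (n i s : ℕ) → List Bool × List ℕ → Set
Unzipped n i s (ms , ns) = IsSubset n i ms × IsComposition n s ns

unzip⁺ : ∀ {n i s} xs → IsColumns (i + s) n i xs → Unzipped n i s (unzip xs)
unzip⁺ xs ((refl , r) , refl) =
  (List.length-unzipWith₁ _ xs , sym (marks-unzip xs)) ,
  (List.length-unzipWith₂ _ xs , +-cancelˡ-≡ (marks xs) _ _ (trans (sym (height-unzip xs)) r))

unzip⁻ : ∀ {n i s} xs → Unzipped n i s (unzip xs) → IsColumns (i + s) n i xs
unzip⁻ xs ((p , q) , (_ , t)) =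
  (trans (sym (List.length-unzipWith₁ _ xs)) p ,
   trans (height-unzip xs) (cong₂ _+_ (trans (marks-unzip xs) q) t)) ,
  trans (marks-unzip xs) q

-- Marks and numbers of `N` steps are chosen independently: an `i`-subset of the `suc b` columns,
-- and a weak composition of the height `s` that the marks leave over.
Fin↔Columns : ∀ b i s →
  Fin ((suc b C i) * ((s + b) C b)) ↔ [ xs ∈ List Column ∣ IsColumns (i + s) (suc b) i xs ]
Fin↔Columns b i s = ↔-trans Fin.*↔× (↔-trans (Fin↔Subsets (suc b) i ×-↔ Fin↔Compositions b s)
  (↔-trans refinement-×-↔ (refinement-↔ (Product.≡-dec _≟ᴮ_ _≟ᴺ_) _≟ᶜ_ (uncurry zip) unzip
    (λ {v} u → unzip⁻ (uncurry zip v) (subst (Unzipped (suc b) i s) (sym (rezip v u)) u))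
    (λ {xs} → unzip⁺ xs)
    (λ _ → List.zip-unzip _)
    (λ {v} → rezip v))))
  where
  rezip : ∀ v → Unzipped (suc b) i s v → unzip (uncurry zip v) ≡ v
  rezip (ms , ns) ((p , _) , (r , _)) = List.unzip-zip ms ns (trans p (sym r))

-- The cycle lemma

cancel-≤ : ∀ {p q r s} → p + q ≤ r + s → s ≤ q → p ≤ r
cancel-≤ {p} {q} {r} e f = +-cancelʳ-≤ q p r (≤-trans e (+-monoʳ-≤ r f))

++-compare : ∀ {A : Set} (us vs us′ vs′ : List A) → us ++ vs ≡ us′ ++ vs′ →
  (∃[ zs ] us ≡ us′ ++ zs × vs′ ≡ zs ++ vs) ⊎ (∃[ zs ] us′ ≡ us ++ zs × vs ≡ zs ++ vs′)
++-compare us vs [] vs′ e = inj₁ (us , refl , sym e)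
++-compare [] vs (u ∷ us′) vs′ e = inj₂ (u ∷ us′ , refl , e)
++-compare (u ∷ us) vs (u′ ∷ us′) vs′ e with refl ← List.∷-injectiveˡ e
  with ++-compare us vs us′ vs′ (List.∷-injectiveʳ e)
... | inj₁ (zs , p , q) = inj₁ (zs , cong (u ∷_) p , q)
... | inj₂ (zs , p , q) = inj₂ (zs , cong (u ∷_) p , q)

take-length-++ : ∀ {A : Set} (xs ys : List A) → take (length xs) (xs ++ ys) ≡ xs
take-length-++ []       ys = refl
take-length-++ (x ∷ xs) ys = cong (x ∷_) (take-length-++ xs ys)

drop-length-++ : ∀ {A : Set} (xs ys : List A) → drop (length xs) (xs ++ ys) ≡ ys
drop-length-++ []       ys = refl
drop-length-++ (x ∷ xs) ys = drop-length-++ xs ys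

module Cycle {A : Set} (weight : A → ℕ) (a b : ℕ) where

  total : List A → ℕ
  total xs = sum (map weight xs)

  total-++ : ∀ us vs → total (us ++ vs) ≡ total us + total vs
  total-++ us vs = trans (cong sum (List.map-++ weight us vs)) (sum-++ (map weight us) (map weight vs))

  -- The walk has already passed `x` entries and reached height `h`. Each inequality is tested at
  -- the right end of a column, after its rise; the start `(x , h)` itself may lie below the line.
  Climbs : ℕ → ℕ → List A → Set
  Climbs x h []       = ⊤
  Climbs x h (y ∷ ys) = a * suc x ≤ b * (h + weight y) × Climbs (suc x) (h + weight y) ys

  climbs? : ∀ x h ys → Dec (Climbs x h ys)
  climbs? x h []       = yes tt
  climbs? x h (y ∷ ys) = (a * suc x ≤? b * (h + weight y)) ×-dec climbs? (suc x) (h + weight y) ys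

  -- Only the excess `b * h - a * x` of the start matters, and the hypothesis says, without
  -- subtraction, that it does not decrease.
  climbs-shift : ∀ {x h x′ h′} ys → a * x′ + b * h ≤ a * x + b * h′ → Climbs x h ys → Climbs x′ h′ ys
  climbs-shift [] e _ = tt
  climbs-shift {x} {h} {x′} {h′} (y ∷ ys) e (p , q) =
    cancel-≤ (≤-trans e′ (≤-reflexive (+-comm (a * suc x) _))) p , climbs-shift ys e′ q
    where
    rearrange : ∀ a x b h w → a * suc x + b * (h + w) ≡ a + b * w + (a * x + b * h)
    rearrange = solve-∀
    e′ : a * suc x′ + b * (h + weight y) ≤ a * suc x + b * (h′ + weight y)
    e′ = subst₂ _≤_ (sym (rearrange a x′ b h (weight y))) (sym (rearrange a x b h′ (weight y)))
           (+-monoʳ-≤ (a + b * weight y) e)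

  climbs-++ : ∀ {x h} us vs → Climbs x h us → Climbs (x + length us) (h + total us) vs → Climbs x h (us ++ vs)
  climbs-++ {x} {h} [] vs _ q rewrite +-identityʳ x | +-identityʳ h = q
  climbs-++ {x} {h} (u ∷ us) vs (p , p′) q = p , climbs-++ us vs p′
    (subst₂ (λ x h → Climbs x h vs) (+-suc x (length us)) (sym (+-assoc h (weight u) (total us))) q)

  climbs-end : ∀ {x h} us vs → Climbs x h (us ++ vs) → a * x ≤ b * h → a * (x + length us) ≤ b * (h + total us)
  climbs-end {x} {h} [] vs _ e rewrite +-identityʳ x | +-identityʳ h = e
  climbs-end {x} {h} (u ∷ us) vs (p , q) e =
    subst₂ (λ x h → a * x ≤ b * h) (sym (+-suc x (length us))) (+-assoc h (weight u) (total us))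
      (climbs-end us vs q p)

  -- Strict, so that a nonempty cycle does not fall: the falling part of a split
  -- is then proper, and its length is a position below b.
  Falls : List A → Set
  Falls []       = ⊤
  Falls (y ∷ ys) = b * total (y ∷ ys) < a * length (y ∷ ys) × Falls ys

  falls-≤ : ∀ us → Falls us → b * total us ≤ a * length us
  falls-≤ []      _       = ≤-reflexive (trans (*-zeroʳ b) (sym (*-zeroʳ a)))
  falls-≤ (_ ∷ _) (p , _) = <⇒≤ p

  mutual

    -- The stretch from any point of `us` to its end falls or is empty, so each such point is at
    -- least as far above the line as the end.
    falls⇒climbs : ∀ {x h} us → Falls us → a * (x + length us) ≤ b * (h + total us) → Climbs x h us
    falls⇒climbs []       _       _ = tt
    falls⇒climbs (y ∷ us) (_ , f) e = falls⇒climbs-∷ y us f e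

    -- The tested points come after `y`, so only the suffixes within `us` have to fall. This form
    -- serves `splitting`, where `x ∷ us` as a whole does not fall.
    falls⇒climbs-∷ : ∀ {x h} y us → Falls us →
      a * (x + length (y ∷ us)) ≤ b * (h + total (y ∷ us)) → Climbs x h (y ∷ us)
    falls⇒climbs-∷ {x} {h} y us f e =
      cancel-≤ (subst₂ _≤_ (*-distribˡ-+ a (suc x) (length us)) (*-distribˡ-+ b (h + weight y) (total us)) e′)
               (falls-≤ us f) ,
      falls⇒climbs us f e′
      where
      e′ : a * (suc x + length us) ≤ b * (h + weight y + total us)
      e′ = subst₂ (λ x h → a * x ≤ b * h) (+-suc x (length us)) (sym (+-assoc h (weight y) (total us))) e

  record Split (xs : List A) : Set where
    constructor split
    field
      falling climbing : List A
      joined : falling ++ climbing ≡ xs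
      falls  : Falls falling
      climbs : Climbs 0 0 climbing

  -- Built from the right: either `x ∷ us` falls strictly and becomes the new falling part, or it
  -- does not, and then the whole list climbs.
  splitting : ∀ xs → Split xs
  splitting [] = split [] [] refl tt tt
  splitting (x ∷ xs) with split us vs joined f c ← splitting xs
    with b * total (x ∷ us) <? a * length (x ∷ us)
  ... | yes p = split (x ∷ us) vs (cong (x ∷_) joined) (p , f) c
  -- The end of `x ∷ us` is not below the line and `us` falls, so `x ∷ us` climbs; `vs` then starts
  -- with nonnegative excess and keeps climbing.
  ... | no ¬p = split [] (x ∷ xs) refl tt (subst (λ xs → Climbs 0 0 (x ∷ xs)) joined
    (climbs-++ (x ∷ us) vs (falls⇒climbs-∷ x us f (≮⇒≥ ¬p))
      (climbs-shift vs (subst₂ _≤_ (sym (trans (cong (a * length (x ∷ us) +_) (*-zeroʳ b)) (+-identityʳ _)))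
                                   (cong (_+ b * total (x ∷ us)) (sym (*-zeroʳ a))) (≮⇒≥ ¬p)) c)))

  IsCycle : List A → Set
  IsCycle xs = length xs ≡ b × total xs ≡ a

  rotate-cycle : ∀ us vs → IsCycle (us ++ vs) → IsCycle (vs ++ us)
  rotate-cycle us vs (p , q) = trans (List.length-++-comm vs us) p ,
    trans (trans (total-++ vs us) (trans (+-comm (total vs) (total us)) (sym (total-++ us vs)))) q

  -- The end of `vs ++ us` is `(b , a)`, on the line, so the falling part `us` stays weakly above
  -- the line on its way there.
  split-climbs : ∀ us vs → IsCycle (us ++ vs) → Falls us → Climbs 0 0 vs → Climbs 0 0 (vs ++ us)
  split-climbs us vs cyc f c with p , q ← rotate-cycle us vs cyc =
    climbs-++ vs us c (falls⇒climbs us f (≤-reflexive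
      (trans (cong (a *_) (trans (sym (List.length-++ vs)) p))
        (trans (*-comm a b) (cong (b *_) (trans (sym q) (total-++ vs us)))))))

  split-proper : .{{_ : NonZero b}} → ∀ us vs → IsCycle (us ++ vs) → Falls us → length us < b
  split-proper [] vs _ _ = n≢0⇒n>0 (λ e → ≢-nonZero⁻¹ b e)
  split-proper us@(_ ∷ _) (_ ∷ vs) (refl , _) _ =
    subst (length us <_) (sym (List.length-++ us)) (m<m+n (length us) z<s)
  split-proper us@(_ ∷ _) [] cyc (f , _) with p , q ← subst IsCycle (List.++-identityʳ us) cyc =
    ⊥-elim (<-irrefl (*-comm b a) (subst₂ (λ x h → b * h < a * x) p q f))

  module _ (coprime : Coprime a b) where

    -- Both parts have nonnegative excess and the excesses add up to zero, so `a * length us` equals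
    -- `b * total us`. Coprimality makes `b` divide `length us`, which is below `b`.
    climbs-unique : ∀ us vs → IsCycle (us ++ vs) → Climbs 0 0 (us ++ vs) → Climbs 0 0 (vs ++ us) →
      length us < b → us ≡ []
    climbs-unique [] vs _ _ _ _ = refl
    climbs-unique us@(_ ∷ _) vs (p , q) c d l = ⊥-elim (<⇒≱ l (∣⇒≤ divisible))
      where
      u : a * length us ≤ b * total us
      u = climbs-end us vs c (≤-reflexive (trans (*-zeroʳ a) (sym (*-zeroʳ b))))
      v : a * length vs ≤ b * total vs
      v = climbs-end vs us d (≤-reflexive (trans (*-zeroʳ a) (sym (*-zeroʳ b))))
      balance : b * total us + b * total vs ≡ a * length us + a * length vs
      balance = begin
        b * total us + b * total vs ≡⟨ *-distribˡ-+ b (total us) (total vs) ⟨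
        b * (total us + total vs)   ≡⟨ cong (b *_) (trans (sym (total-++ us vs)) q) ⟩
        b * a                       ≡⟨ *-comm b a ⟩
        a * b                       ≡⟨ cong (a *_) (trans (sym p) (List.length-++ us)) ⟩
        a * (length us + length vs) ≡⟨ *-distribˡ-+ a (length us) (length vs) ⟩
        a * length us + a * length vs ∎
        where open ≡-Reasoning
      level : a * length us ≡ b * total us
      level = ≤-antisym u (cancel-≤ (≤-reflexive balance) v)
      divisible : b ∣ length us
      divisible = coprime-divisor (Coprimality.sym coprime)
        (divides (total us) (trans level (*-comm b (total us))))

    -- The two cuts differ by the piece `zs`, so one climbing rotation is the other rotated by `zs`,
    -- and `climbs-unique` makes `zs` empty.
    longer-rotation : ∀ us zs vs → IsCycle ((us ++ zs) ++ vs) → Climbs 0 0 (vs ++ us ++ zs) →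
      Climbs 0 0 ((zs ++ vs) ++ us) → length (us ++ zs) < b → us ++ zs ≡ us × vs ≡ zs ++ vs
    longer-rotation us zs vs cyc c c′ l
      with refl ← climbs-unique zs (vs ++ us)
             (subst IsCycle (List.++-assoc zs vs us)
               (rotate-cycle us (zs ++ vs) (subst IsCycle (List.++-assoc us zs vs) cyc)))
             (subst (Climbs 0 0) (List.++-assoc zs vs us) c′)
             (subst (Climbs 0 0) (sym (List.++-assoc vs us zs)) c)
             (≤-<-trans (List.length-++-≤ʳ zs {us}) l) =
      List.++-identityʳ us , refl

    rotation-unique : ∀ us vs us′ vs′ → us ++ vs ≡ us′ ++ vs′ → IsCycle (us ++ vs) →
      Climbs 0 0 (vs ++ us) → Climbs 0 0 (vs′ ++ us′) → length us < b → length us′ < b →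
      us ≡ us′ × vs ≡ vs′
    rotation-unique us vs us′ vs′ e cyc c c′ l l′ with ++-compare us vs us′ vs′ e
    ... | inj₁ (zs , refl , refl) = longer-rotation us′ zs vs cyc c c′ l
    ... | inj₂ (zs , refl , refl)
      with p , q ← longer-rotation us zs vs′ (subst IsCycle (sym (List.++-assoc us zs vs′)) cyc) c′ c l′ =
      sym p , sym q

    -- `r` is the length of the falling part that was moved, `ys` the climbing rotation, and `R` a
    -- side condition, later a prescribed number of marks.
    Positioned : (List A → Set) → ℕ × List A → Set
    Positioned R (r , ys) = r < b × (IsCycle ys × R ys) × Climbs 0 0 ys

    -- The cycle lemma as a bijection: a cycle corresponds to its climbing rotation together with a
    -- cut position, which is arbitrary below `b`. So there are `b` times as many cycles as climbing
    -- ones.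
    rotations : .{{_ : NonZero b}} → DecidableEquality (List A) →
      (R : List A → Set) → (∀ us vs → R (us ++ vs) → R (vs ++ us)) →
      [ xs ∈ List A ∣ IsCycle xs × R xs ] ↔
      [ y ∈ ℕ × List A ∣ Positioned R y ]
    rotations _≟A_ R rotate-R = refinement-↔ _≟A_ (Product.≡-dec _≟_ _≟A_) to from to⁺ from⁺ to∘from from∘to
      where
      to : List A → ℕ × List A
      to xs = let split us vs _ _ _ = splitting xs in length us , vs ++ us

      from : ℕ × List A → List A
      -- The falling part of length `r` stands at the end of `ys`, after `b ∸ r` entries.
      from (r , ys) = drop (b ∸ r) ys ++ take (b ∸ r) ys

      to⁺ : ∀ {xs} → IsCycle xs × R xs → Positioned R (to xs)
      to⁺ {xs} (cyc , r) with split us vs refl f c ← splitting xs =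
        split-proper us vs cyc f , (rotate-cycle us vs cyc , rotate-R us vs r) , split-climbs us vs cyc f c

      from⁺ : ∀ {y} → Positioned R y → IsCycle (from y) × R (from y)
      from⁺ {r , ys} (_ , (cyc , r′) , _) =
        rotate-cycle (take n ys) (drop n ys) (subst IsCycle (sym whole) cyc) ,
        rotate-R (take n ys) (drop n ys) (subst R (sym whole) r′)
        where
        n = b ∸ r
        whole = List.take++drop≡id n ys

      to∘from : ∀ {y} → Positioned R y → to (from y) ≡ y
      to∘from {r , ys} (l , (cyc , _) , c) = go (splitting (from (r , ys)))
        where
        n = b ∸ r
        whole = List.take++drop≡id n ys
        cyc′ = rotate-cycle (take n ys) (drop n ys) (subst IsCycle (sym whole) cyc)
        length-drop : length (drop n ys) ≡ r
        length-drop = trans (List.length-drop n ys) (trans (cong (_∸ n) (proj₁ cyc)) (m∸[m∸n]≡n (<⇒≤ l)))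
        -- Splitting might cut elsewhere than at `r`; both cuts give climbing rotations, so
        -- `rotation-unique` identifies them.
        go : (s : Split (from (r , ys))) →
             (length (Split.falling s) , Split.climbing s ++ Split.falling s) ≡ (r , ys)
        go (split us vs joined f c′)
          with p , q ← rotation-unique us vs (drop n ys) (take n ys) joined (subst IsCycle (sym joined) cyc′)
                 (split-climbs us vs (subst IsCycle (sym joined) cyc′) f c′)
                 (subst (Climbs 0 0) (sym whole) c)
                 (split-proper us vs (subst IsCycle (sym joined) cyc′) f)
                 (subst (_< b) (sym length-drop) l) =
          cong₂ _,_ (trans (cong length p) length-drop) (trans (cong₂ _++_ q p) whole)

      from∘to : ∀ {xs} → IsCycle xs × R xs → from (to xs) ≡ xs
      from∘to {xs} ((p , _) , _) with split us vs refl f c ← splitting xs =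
        cong₂ _++_ (trans (cong (λ n → drop n (vs ++ us)) n≡) (drop-length-++ vs us))
                   (trans (cong (λ n → take n (vs ++ us)) n≡) (take-length-++ vs us))
        where
        n≡ : b ∸ length us ≡ length vs
        n≡ = trans (cong (_∸ length us) (trans (sym p) (List.length-++ us))) (m+n∸m≡n (length us) (length vs))

-- Paths as sequences of columns

module _ (a b : ℕ) where
  open Lowest

  -- `ν a b` crosses column `x` horizontally at the least height `g` with `a * suc x ≤ b * g`. Lying
  -- above it there amounts to one inequality at the left end of the step, for `D` as for `E`.
  Clear : ℕ → ℕ → List Step → Set
  Clear x y []      = ⊤
  Clear x y (N ∷ w) = Clear x (suc y) w
  Clear x y (E ∷ w) = a * suc x ≤ b * y × Clear (suc x) y w
  Clear x y (D ∷ w) = a * suc x ≤ b * y × Clear (suc x) (suc y) w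

  -- `greedy` proceeds step by step; this describes its jump over the next `N` steps to an `E` at
  -- height `g`, with `n′` steps `N` left.
  record GreedyColumn (x y e : ℕ) (cs : List (ℕ × ℕ)) : Set where
    constructor greedyColumn
    field
      g n′    : ℕ
      room    : g + n′ ≡ a
      y≤g     : y ≤ g
      above   : a * suc x ≤ b * g
      minimal : ∀ {h} → y ≤ h → a * suc x ≤ b * h → g ≤ h
      columns : cs ≡ (g , g) ∷ profile g (greedy a b (suc x) g e n′)

  greedy-column : ∀ x y e n → x + suc e ≡ b → y + n ≡ a →
    GreedyColumn x y e (profile y (greedy a b x y (suc e) n))
  greedy-column x y e n p q with a * suc x ≤? b * y
  greedy-column x y e n p q | yes s = greedyColumn y n q ≤-refl s (λ l _ → l) refl
  greedy-column x y e (suc n) p q | no s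
    with greedyColumn g n′ r l t m c ← greedy-column x (suc y) e n p (trans (sym (+-suc y n)) q) =
    greedyColumn g n′ r (m+n≤o⇒n≤o 1 l) t (λ l′ t′ → m (≤∧≢⇒< l′ λ { refl → s t′ }) t′) c
  greedy-column x y e zero p q | no s = ⊥-elim (s (stuck x y e p q))

  dominates⇒clear : ∀ x y e n y′ w → x + e ≡ b → y + n ≡ a → y ≤ y′ →
    Dominates (profile y′ w) (profile y (greedy a b x y e n)) → Clear x y′ w
  dominates⇒clear x y e n y′ [] _ _ _ _ = tt
  dominates⇒clear x y e n y′ (N ∷ w) p q r d = dominates⇒clear x y e n (suc y′) w p q (m≤n⇒m≤1+n r) d
  dominates⇒clear x y zero n y′ (E ∷ w) p q r d with () ← subst (Dominates _) (profile-N y n) d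
  dominates⇒clear x y zero n y′ (D ∷ w) p q r d with () ← subst (Dominates _) (profile-N y n) d
  dominates⇒clear x y (suc e) n y′ (E ∷ w) p q r d
    with greedyColumn g n′ s _ t _ c ← greedy-column x y e n p q
    with (u , _) ∷ d ← subst (Dominates _) c d =
    ≤-trans t (*-monoʳ-≤ b u) , dominates⇒clear (suc x) g e n′ y′ w (trans (sym (+-suc x e)) p) s u d
  dominates⇒clear x y (suc e) n y′ (D ∷ w) p q r d
    with greedyColumn g n′ s _ t _ c ← greedy-column x y e n p q
    with (u , _) ∷ d ← subst (Dominates _) c d =
    ≤-trans t (*-monoʳ-≤ b u) , dominates⇒clear (suc x) g e n′ (suc y′) w (trans (sym (+-suc x e)) p) s
      (m≤n⇒m≤1+n u) d

  -- `minimal` turns the inequality of `Clear` into `g ≤ y′`, and the right end of the step is no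
  -- lower than its left end.
  clear⇒dominates : ∀ x y e n y′ w → x + e ≡ b → y + n ≡ a → y ≤ y′ → proj₁ (endpoint (x , y′) w) ≡ b →
    Clear x y′ w → Dominates (profile y′ w) (profile y (greedy a b x y e n))
  clear⇒dominates x y (suc e) n y′ [] p q r z c = ⊥-elim (m≢1+m+n x (trans z (trans (sym p) (+-suc x e))))
  clear⇒dominates x y zero n y′ w p q r z c
    rewrite profile-N y n | profile-vertical x y′ w (trans z (trans (sym p) (+-identityʳ x))) = []
  clear⇒dominates x y (suc e) n y′ (N ∷ w) p q r z c =
    clear⇒dominates x y (suc e) n (suc y′) w p q (m≤n⇒m≤1+n r) z c
  clear⇒dominates x y (suc e) n y′ (E ∷ w) p q r z (u , c)
    with greedyColumn g n′ s _ _ m k ← greedy-column x y e n p q = subst (Dominates _) (sym k)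
    ((m r u , m r u) ∷ clear⇒dominates (suc x) g e n′ y′ w (trans (sym (+-suc x e)) p) s (m r u) z c)
  clear⇒dominates x y (suc e) n y′ (D ∷ w) p q r z (u , c)
    with greedyColumn g n′ s _ _ m k ← greedy-column x y e n p q = subst (Dominates _) (sym k)
    ((m r u , m≤n⇒m≤1+n (m r u)) ∷
     clear⇒dominates (suc x) g e n′ (suc y′) w (trans (sym (+-suc x e)) p) s (m≤n⇒m≤1+n (m r u)) z c)

-- Conversion between words of steps and sequences of columns.

data EndsInE : List Step → Set where
  last : EndsInE (E ∷ [])
  _∷_  : ∀ s {w} → EndsInE w → EndsInE (s ∷ w)

-- `m` and `n` belong to the column being read: its mark and the `N` steps seen so far. It is
-- emitted only at its `E` or `D`.
columns : Bool → ℕ → List Step → List Column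
columns m n []      = []
columns m n (N ∷ w) = columns m (suc n) w
columns m n (E ∷ w) = (m , n) ∷ columns false 0 w
columns m n (D ∷ w) = (m , n) ∷ columns true 0 w

mutual

  path : List Column → List Step
  path []             = []
  path ((_ , n) ∷ xs) = replicate n N ++ horizontal xs ∷ path xs

  -- The step at the right end of a column, read off from the mark of the next column.
  horizontal : List Column → Step
  horizontal ((true , _) ∷ _) = D
  horizontal _                = E

columns-replicate : ∀ m k n w → columns m k (replicate n N ++ w) ≡ columns m (n + k) w
columns-replicate m k zero w = refl
columns-replicate m k (suc n) w =
  trans (columns-replicate m (suc k) n w) (cong (λ n → columns m n w) (+-suc n k))

FirstMark : Bool → List Column → Set
FirstMark m []             = ⊤
FirstMark m ((m′ , _) ∷ _) = m′ ≡ m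

-- `path` never reads the mark of the first column; `m` supplies it again, and `FirstMark` says that
-- it is the right one.
columns-path : ∀ m xs → FirstMark m xs → columns m 0 (path xs) ≡ xs
columns-path m [] _ = refl
columns-path m ((_ , n) ∷ xs) refl =
  trans (columns-replicate m 0 n _) (trans (step xs) (cong (λ n → (m , n) ∷ xs) (+-identityʳ n)))
  where
  step : ∀ xs → columns m (n + 0) (horizontal xs ∷ path xs) ≡ (m , n + 0) ∷ xs
  step []                = refl
  step ys@((true , _) ∷ _)  = cong (_ ∷_) (columns-path true ys refl)
  step ys@((false , _) ∷ _) = cong (_ ∷_) (columns-path false ys refl)

columns-firstMark : ∀ m n w → FirstMark m (columns m n w)
columns-firstMark m n []      = tt
columns-firstMark m n (N ∷ w) = columns-firstMark m (suc n) w
columns-firstMark m n (E ∷ w) = refl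
columns-firstMark m n (D ∷ w) = refl

-- A `D` is recorded in the column after it. For `m = true` that column must exist, and `EndsInE`
-- provides it.
horizontal-columns : ∀ m n {w} → EndsInE w → horizontal (columns m n w) ≡ (if m then D else E)
horizontal-columns false n {w} _ with columns false n w | columns-firstMark false n w
... | [] | _ = refl
... | (false , _) ∷ _ | _ = refl
horizontal-columns true n last = refl
horizontal-columns true n (N ∷ e) = horizontal-columns true (suc n) e
horizontal-columns true n (E ∷ e) = refl
horizontal-columns true n (D ∷ e) = refl

-- Words ending in `N` or `D` could not be recovered: trailing `N` steps belong to no column, and a
-- last `D` has no next column to mark.
path-columns : ∀ m n {w} → EndsInE w → path (columns m n w) ≡ replicate n N ++ w
path-columns m n last = refl
path-columns m n (N ∷ e) = trans (path-columns m (suc n) e) (sym (shift n _))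
  where
  shift : ∀ n w → replicate n N ++ N ∷ w ≡ N ∷ replicate n N ++ w
  shift zero w = refl
  shift (suc n) w = cong (N ∷_) (shift n w)
path-columns m n (E ∷ e) =
  cong (replicate n N ++_) (cong₂ _∷_ (horizontal-columns false 0 e) (path-columns false 0 e))
path-columns m n (D ∷ e) =
  cong (replicate n N ++_) (cong₂ _∷_ (horizontal-columns true 0 e) (path-columns true 0 e))

path-endsInE : ∀ x xs → EndsInE (path (x ∷ xs))
path-endsInE (_ , n) xs = prepend n (after xs)
  where
  prepend : ∀ n {w} → EndsInE w → EndsInE (replicate n N ++ w)
  prepend zero e = e
  prepend (suc n) e = N ∷ prepend n e
  after : ∀ xs → EndsInE (horizontal xs ∷ path xs)
  after [] = last
  after (x ∷ xs) = horizontal (x ∷ xs) ∷ path-endsInE x xs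

-- `h` is the height before the rise of the current column; the word starts after the unit gained
-- along the preceding `D`, if any, and after `n` steps `N`.
columns-endpoint : ∀ x h m n {w} → EndsInE w →
  endpoint (x , h + rise (m , n)) w ≡ (x + length (columns m n w) , h + height (columns m n w))
columns-endpoint x h m n last = cong₂ _,_ (sym (+-comm x 1)) (cong (h +_) (sym (+-identityʳ _)))
columns-endpoint x h m n (N ∷ e) rewrite sym (+-suc h (rise (m , n))) | sym (+-suc (bit m) n) =
  columns-endpoint x h m (suc n) e
columns-endpoint x h m n (_∷_ E {w} e) = trans
  (trans (cong (λ h → endpoint (suc x , h) w) (sym (+-identityʳ _)))
         (columns-endpoint (suc x) (h + rise (m , n)) false 0 e))
  (cong₂ _,_ (sym (+-suc x _)) (+-assoc h _ _))
columns-endpoint x h m n (_∷_ D {w} e) = trans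
  (trans (cong (λ h → endpoint (suc x , h) w) (+-comm 1 _))
         (columns-endpoint (suc x) (h + rise (m , n)) true 0 e))
  (cong₂ _,_ (sym (+-suc x _)) (+-assoc h _ _))

columns-marks : ∀ m n {w} → EndsInE w → marks (columns m n w) ≡ bit m + diagonals w
columns-marks m n last = refl
columns-marks m n (N ∷ e) = columns-marks m (suc n) e
columns-marks m n (E ∷ e) = cong (bit m +_) (columns-marks false 0 e)
columns-marks m n (D ∷ e) = cong (bit m +_) (columns-marks true 0 e)

-- Schröder paths as climbing sequences with unmarked first column.

module _ (a b : ℕ) where
  open Cycle rise a b

  -- `Clear` tests the height just before a horizontal step, `Climbs` the height after the rise of a
  -- column; these are the same number.
  clear⇒climbs : ∀ x h m n w → Clear a b x (h + rise (m , n)) w → Climbs x h (columns m n w)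
  clear⇒climbs x h m n []      c = tt
  clear⇒climbs x h m n (N ∷ w) c = clear⇒climbs x h m (suc n) w
    (subst (λ y → Clear a b x y w) (sym (trans (cong (h +_) (+-suc (bit m) n)) (+-suc h _))) c)
  clear⇒climbs x h m n (E ∷ w) (p , c) = p , clear⇒climbs (suc x) (h + rise (m , n)) false 0 w
    (subst (λ y → Clear a b (suc x) y w) (sym (+-identityʳ _)) c)
  clear⇒climbs x h m n (D ∷ w) (p , c) = p , clear⇒climbs (suc x) (h + rise (m , n)) true 0 w
    (subst (λ y → Clear a b (suc x) y w) (+-comm 1 _) c)

  climbs⇒clear : ∀ x h m n w → Climbs x h (columns m n w) → Clear a b x (h + rise (m , n)) w
  climbs⇒clear x h m n []      c = tt
  climbs⇒clear x h m n (N ∷ w) c =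
    subst (λ y → Clear a b x y w) (trans (cong (h +_) (+-suc (bit m) n)) (+-suc h _))
      (climbs⇒clear x h m (suc n) w c)
  climbs⇒clear x h m n (E ∷ w) (p , c) = p , subst (λ y → Clear a b (suc x) y w) (+-identityʳ _)
    (climbs⇒clear (suc x) (h + rise (m , n)) false 0 w c)
  climbs⇒clear x h m n (D ∷ w) (p , c) = p , subst (λ y → Clear a b (suc x) y w) (+-comm _ 1)
    (climbs⇒clear (suc x) (h + rise (m , n)) true 0 w c)

  endpoint-≥ : ∀ x y w → endpoint (x , y) w ≡ (b , a) → x ≤ b × y ≤ a
  endpoint-≥ x y w refl = Lowest.endpoint-mono x y w

  ends-at-top : ∀ y w → endpoint (b , y) w ≡ (b , a) → a ≤ y → w ≡ []
  ends-at-top y []      _ _ = refl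
  ends-at-top y (N ∷ w) e l = ⊥-elim (<⇒≱ (proj₂ (endpoint-≥ b (suc y) w e)) l)
  ends-at-top y (E ∷ w) e l = ⊥-elim (1+n≰n (proj₁ (endpoint-≥ (suc b) y w e)))
  ends-at-top y (D ∷ w) e l = ⊥-elim (1+n≰n (proj₁ (endpoint-≥ (suc b) (suc y) w e)))

  at-top : .{{_ : NonZero b}} → ∀ {y} → a * b ≤ b * y → a ≤ y
  at-top {y} p = *-cancelˡ-≤ b (subst (_≤ b * y) (*-comm a b) p)

  -- The step that reaches `x = b` starts at height at least `a`: a `D` there would overshoot, and
  -- after an `E` no step is left.
  clear⇒endsInE : .{{_ : NonZero b}} → ∀ x y w → x < b →
    endpoint (x , y) w ≡ (b , a) → Clear a b x y w → EndsInE w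
  clear⇒endsInE x y [] l e c = ⊥-elim (<-irrefl (cong proj₁ e) l)
  clear⇒endsInE x y (N ∷ w) l e c = N ∷ clear⇒endsInE x (suc y) w l e c
  clear⇒endsInE x y (E ∷ w) l e (p , c) with suc x ≟ b
  ... | no x≢b = E ∷ clear⇒endsInE (suc x) y w (≤∧≢⇒< l x≢b) e c
  ... | yes refl with refl ← ends-at-top y w e (at-top p) = last
  clear⇒endsInE x y (D ∷ w) l e (p , c) with suc x ≟ b
  ... | no x≢b = D ∷ clear⇒endsInE (suc x) (suc y) w (≤∧≢⇒< l x≢b) e c
  ... | yes refl = ⊥-elim (<⇒≱ (proj₂ (endpoint-≥ (suc x) (suc y) w e)) (at-top p))

  IsSchröderColumns : ℕ → List Column → Set
  IsSchröderColumns i xs = (IsColumns a b i xs × Climbs 0 0 xs) × FirstMark false xs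

  _≟ˢ_ : DecidableEquality Step
  N ≟ˢ N = yes refl
  N ≟ˢ E = no λ ()
  N ≟ˢ D = no λ ()
  E ≟ˢ N = no λ ()
  E ≟ˢ E = yes refl
  E ≟ˢ D = no λ ()
  D ≟ˢ N = no λ ()
  D ≟ˢ E = no λ ()
  D ≟ˢ D = yes refl

  Schröder↔columns : .{{_ : NonZero b}} → ∀ i →
    [ xs ∈ List Column ∣ IsSchröderColumns i xs ] ↔ SchröderPath a b i
  Schröder↔columns i = refinement-↔ _≟ᶜ_ (List.≡-dec _≟ˢ_) path (columns false 0) to⁺ from⁺ fg
    (λ { {xs} (_ , f) → columns-path false xs f })
    where
    b>0 : 0 < b
    b>0 = n≢0⇒n>0 (≢-nonZero⁻¹ b)

    clear : ∀ {w} → IsSchröderPath a b w → Clear a b 0 0 w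
    clear {w} s = dominates⇒clear a b 0 0 b a 0 w refl refl z≤n (IsSchröderPath.above s)

    ends : ∀ {w} → IsSchröderPath a b w → EndsInE w
    ends {w} s = clear⇒endsInE 0 0 w b>0 (IsSchröderPath.reaches s) (clear s)

    fg : ∀ {w} → IsSchröderPath a b w × diagonals w ≡ i → path (columns false 0 w) ≡ w
    fg (s , _) = path-columns false 0 (ends s)

    from⁺ : ∀ {w} → IsSchröderPath a b w × diagonals w ≡ i → IsSchröderColumns i (columns false 0 w)
    from⁺ {w} (s , d)
      with p , q ← Product.,-injective (trans (sym (columns-endpoint 0 0 false 0 (ends s))) (IsSchröderPath.reaches s)) =
      (((p , q) , trans (columns-marks false 0 (ends s)) d) , clear⇒climbs 0 0 false 0 w (clear s)) ,
      columns-firstMark false 0 w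

    to⁺ : ∀ {xs} → IsSchröderColumns i xs → IsSchröderPath a b (path xs) × diagonals (path xs) ≡ i
    to⁺ {[]} ((((p , _) , _) , _) , _) = ⊥-elim (<-irrefl p b>0)
    to⁺ {xs@(x ∷ xs′)} ((((p , q) , r) , c) , f) =
      schröderPath reach (clear⇒dominates a b 0 0 b a 0 (path xs) refl refl z≤n (cong proj₁ reach)
        (climbs⇒clear 0 0 false 0 (path xs) (subst (Climbs 0 0) (sym inv) c))) ,
      trans (sym (columns-marks false 0 end)) (trans (cong marks inv) r)
      where
      end = path-endsInE x xs′
      inv = columns-path false xs f
      reach : endpoint (0 , 0) (path xs) ≡ (b , a)
      reach = trans (columns-endpoint 0 0 false 0 end)
        (cong₂ _,_ (trans (cong length inv) p) (trans (cong height inv) q))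

  IsClimbing : ℕ → List Column → Set
  IsClimbing i xs = IsColumns a b i xs × Climbs 0 0 xs

  firstMark? : ∀ m xs → Dec (FirstMark m xs)
  firstMark? m []             = yes tt
  firstMark? m ((m′ , _) ∷ _) = m′ Bool.≟ m

  -- Trading the mark of the first column for an `N` step keeps its rise, hence the height and the
  -- climbing condition, and changes the number of marks by one.
  unmark-first : .{{_ : NonZero a}} → ∀ i →
    [ z ∈ _ ∣ [ IsSchröderColumns (suc i) , IsSchröderColumns i ]′ z ] ↔
    [ xs ∈ List Column ∣ IsClimbing (suc i) xs ]
  unmark-first i = refinement-↔ (Sum.≡-dec _≟ᶜ_ _≟ᶜ_) _≟ᶜ_ mark unmark (λ {z} → to⁺ {z}) (λ {xs} → from⁺ {xs})
    fg (λ {z} → gf {z})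
    where
    mark : List Column ⊎ List Column → List Column
    mark (inj₁ xs) = xs
    -- Default value; `positive` excludes the empty sequence, whose height is 0.
    mark (inj₂ []) = []
    mark (inj₂ ((_ , n) ∷ xs)) = (true , pred n) ∷ xs

    unmark : List Column → List Column ⊎ List Column
    unmark ((true , n) ∷ xs) = inj₂ ((false , suc n) ∷ xs)
    unmark xs = inj₁ xs

    -- Such a first column has rise 0, while climbing asks for `a * 1 ≤ b * 0`. Hence `pred` in
    -- `mark` only meets positive numbers.
    nonempty : ∀ {A : Set} {xs} → IsSchröderColumns i ((false , 0) ∷ xs) → A
    nonempty ((_ , (p , _)) , _) = ⊥-elim (<⇒≱ (n≢0⇒n>0 (≢-nonZero⁻¹ a))
      (subst₂ _≤_ (*-identityʳ a) (*-zeroʳ b) p))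

    positive : ∀ {A : Set} → IsSchröderColumns i [] → A
    positive ((((_ , q) , _) , _) , _) = ⊥-elim (≢-nonZero⁻¹ a (sym q))

    to⁺ : ∀ {z} → [ IsSchröderColumns (suc i) , IsSchröderColumns i ]′ z → IsClimbing (suc i) (mark z)
    to⁺ {inj₁ _} (r , _) = r
    to⁺ {inj₂ []} s = positive s
    to⁺ {inj₂ ((true , _) ∷ _)} (_ , ())
    to⁺ {inj₂ ((false , zero) ∷ _)} s = nonempty s
    to⁺ {inj₂ ((false , suc n) ∷ xs)} (((p , q) , c) , _) = (p , cong suc q) , c

    from⁺ : ∀ {xs} → IsClimbing (suc i) xs → [ IsSchröderColumns (suc i) , IsSchröderColumns i ]′ (unmark xs)
    from⁺ {[]} r = r , tt
    from⁺ {(true , n) ∷ xs} ((p , q) , c) = ((p , suc-injective q) , c) , refl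
    from⁺ {(false , n) ∷ xs} r = r , refl

    fg : ∀ {xs} → IsClimbing (suc i) xs → mark (unmark xs) ≡ xs
    fg {[]} _ = refl
    fg {(true , n) ∷ xs} _ = refl
    fg {(false , n) ∷ xs} _ = refl

    gf : ∀ {z} → [ IsSchröderColumns (suc i) , IsSchröderColumns i ]′ z → unmark (mark z) ≡ z
    gf {inj₁ []} _ = refl
    gf {inj₁ ((false , _) ∷ _)} _ = refl
    gf {inj₁ ((true , _) ∷ _)} (_ , ())
    gf {inj₂ []} s = positive s
    gf {inj₂ ((true , _) ∷ _)} (_ , ())
    gf {inj₂ ((false , zero) ∷ _)} s = nonempty s
    gf {inj₂ ((false , suc n) ∷ xs)} _ = refl

-- Enumeration of Schröder paths

marks-rotate : ∀ us vs → marks (us ++ vs) ≡ marks (vs ++ us)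
marks-rotate us vs = trans (marks-++ us vs) (trans (+-comm (marks us) (marks vs)) (sym (marks-++ vs us)))
  where
  mark : Column → ℕ
  mark (m , _) = bit m
  marks-++ : ∀ us vs → marks (us ++ vs) ≡ marks us + marks vs
  marks-++ us vs = trans (cong sum (List.map-++ mark us vs)) (sum-++ (map mark us) (map mark vs))

module Counting (a′ b′ : ℕ) (coprime : Coprime (suc a′) (suc b′)) where

  a = suc a′
  b = suc b′

  open Cycle rise a b

  finite-columns : ∀ i → i ≤ a →
    Fin ((b C i) * ((a ∸ i + b′) C b′)) ↔ [ xs ∈ List Column ∣ IsColumns a b i xs ]
  finite-columns i i≤a = subst
    (λ n → Fin ((b C i) * ((a ∸ i + b′) C b′)) ↔ [ xs ∈ List Column ∣ IsColumns n b i xs ])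
    (m+[n∸m]≡n i≤a) (Fin↔Columns b′ i (a ∸ i))

  finite-climbing : ∀ i → i ≤ a → ∃[ m ] Fin m ↔ [ xs ∈ List Column ∣ IsClimbing a b i xs ]
  finite-climbing i i≤a = finite-subset (finite-columns i i≤a) (climbs? 0 0)

  -- Paired with the `b` cut positions, the climbing sequences enumerate all column sequences
  -- through `rotations`; the two sizes are then compared.
  climbing-count : ∀ {i m} → i ≤ a → Fin m ↔ [ xs ∈ List Column ∣ IsClimbing a b i xs ] →
    b * m ≡ (b C i) * ((a ∸ i + b′) C b′)
  climbing-count {i} {m} i≤a e = ↔⇒≡ (↔-trans Fin.*↔× (↔-trans (Fin↔below b ×-↔ e) (↔-trans refinement-×-↔
    (↔-trans (↔-sym (rotations coprime _≟ᶜ_ (λ xs → marks xs ≡ i) (λ us vs → trans (marks-rotate vs us))))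
      (↔-sym (finite-columns i i≤a))))))

  unmark-zero : [ xs ∈ List Column ∣ IsClimbing a b 0 xs ] ↔
                [ xs ∈ List Column ∣ IsSchröderColumns a b 0 xs ]
  unmark-zero = refinement-↔ _≟ᶜ_ _≟ᶜ_ (λ xs → xs) (λ xs → xs)
    (λ {xs} r → r , unmarked {xs} r) proj₁ (λ _ → refl) (λ _ → refl)
    where
    unmarked : ∀ {xs} → IsClimbing a b 0 xs → FirstMark false xs
    unmarked {[]} _ = _
    unmarked {(false , _) ∷ xs} _ = refl
    unmarked {(true , _) ∷ xs} ((_ , ()) , _)

  finite-schröder : ∀ i → i ≤ a → ∃[ m ] Fin m ↔ [ xs ∈ List Column ∣ IsSchröderColumns a b i xs ]
  finite-schröder i i≤a = finite-subset (proj₂ (finite-climbing i i≤a)) (firstMark? a b _)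

  -- Induction on `i`, for an arbitrary enumeration `e`. Joined with one for `i` marks, it
  -- enumerates the climbing sequences with `suc i` marks, and the term `scaled a b i` cancels from
  -- the recurrence.
  schröder-count : ∀ {i m} → i < a → Fin m ↔ [ xs ∈ List Column ∣ IsSchröderColumns a b i xs ] →
    b * m ≡ scaled a b i
  schröder-count {zero} {m} _ e =
    trans (climbing-count {0} {m} z≤n (↔-trans e (↔-sym unmark-zero))) (sym (scaled-zero a′ b′))
  schröder-count {suc i} {m} i<a e = +-cancelʳ-≡ (scaled a b i) (b * m) (scaled a b (suc i)) (begin
    b * m + scaled a b i
      ≡⟨ cong (λ r → b * m + r) (schröder-count {i} {n} (<-trans (n<1+n i) i<a) f) ⟨
    b * m + b * n                         ≡⟨ *-distribˡ-+ b m n ⟨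
    b * (m + n)                           ≡⟨ climbing-count {suc i} {m + n} (<⇒≤ i<a)
                                               (↔-trans Fin.+↔⊎ (↔-trans (e ⊎-↔ f)
                                                 (↔-trans refinement-⊎-↔ (unmark-first a b i)))) ⟩
    (b C suc i) * ((a ∸ suc i + b′) C b′) ≡⟨ scaled-recurrence a′ b′ {i} (≤-pred i<a) ⟨
    scaled a b (suc i) + scaled a b i     ∎)
    where
    open ≡-Reasoning
    i≤a = ≤-trans (n≤1+n i) (<⇒≤ i<a)
    n = proj₁ (finite-schröder i i≤a)
    f = proj₂ (finite-schröder i i≤a)

-- The closed forms as rational numbers.

open import Data.Integer as ℤ using (+_)

quotient-≡ : ∀ m n d .{{_ : NonZero d}} → d * m ≡ n → + m / 1 ≡ + n / d
quotient-≡ m n (suc d) e = fromℚᵘ-cong {mkℚᵘ (+ m) 0} {mkℚᵘ (+ n) d} (*≡* (begin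
  + m ℤ.* + suc d ≡⟨ ℤ.pos-* m (suc d) ⟨
  + (m * suc d)   ≡⟨ cong +_ (trans (*-comm m (suc d)) e) ⟩
  + n             ≡⟨ ℤ.*-identityʳ (+ n) ⟨
  + n ℤ.* + 1     ∎))
  where open ≡-Reasoning

proposition2p14 : (a b : ℕ) .{{_ : NonZero a}} .{{_ : NonZero b}} → Coprime a b →
    (i : ℕ) → i < a →
    ∃[ sch ] (Fin sch ↔ SchröderPath a b i)
    × + sch / 1 ≡ + (((b ∸ 1) C i) * ((a + b ∸ 1 ∸ i) C b)) / a
    × + sch / 1 ≡ + (((a ∸ 1) C i) * ((a + b ∸ 1 ∸ i) C a)) / b
proposition2p14 (suc a) (suc b) coprime i i<a =
  m , ↔-trans e (Schröder↔columns (suc a) (suc b) i) ,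
  -- Counting gives the formula with denominator `suc b`; the other one follows by
  -- `scaled-symmetric` once both sides are multiplied by `suc b`.
  quotient-≡ m _ (suc a) (*-cancelˡ-≡ _ _ (suc b) (begin
    suc b * (suc a * m) ≡⟨ x∙yz≈y∙xz (suc b) (suc a) m ⟩
    suc a * (suc b * m) ≡⟨ cong (suc a *_) count ⟩
    suc a * scaled (suc a) (suc b) i ≡⟨ scaled-symmetric a b {i} (≤-pred i<a) ⟩
    suc b * ((b C i) * ((suc a + suc b ∸ 1 ∸ i) C suc b)) ∎)) ,
  quotient-≡ m _ (suc b) count
  where
  open ≡-Reasoning
  m = proj₁ (Counting.finite-schröder a b coprime i (<⇒≤ i<a))
  e = proj₂ (Counting.finite-schröder a b coprime i (<⇒≤ i<a))
  count : suc b * m ≡ scaled (suc a) (suc b) i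
  count = Counting.schröder-count a b coprime {i} {m} i<a e
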